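{- Let $s_{l_1},s_{l_2},\dots,s_{l_t}$ be a finite number ($t\ge 1$) of ordered strings of non-negative integers, and for each $i$ let $k_i$ be the maximum entry of $s_{l_i}$. Then the generalised ornated graph $O_n(s_{l_1},\dots,s_{l_t})$ of smallest order $n$ that attains the maximum possible degree $\max_{n'\ge 1}\Delta(O_{n'}(s_{l_1},\dots,s_{l_t}))$ has $n=2\max_{1\le i\le t}k_i+1$ vertices, and for this $n$ one has $\Delta(O_n(s_{l_1},s_{l_2},\dots,s_{l_t}))=\sum_{j=1}^{t}\Delta(O_n(s_{l_j}))$.
   Context: An ordered string $s_l=(a_j)$, $1\le j\le l$ ($l\ge 1$), is an $l$-tuple of non-negative integers; $j$ is the index of the entry $a_j$. For a positive integer $n$, the ornated graph $O_n(s_l)$ is the (in general non-simple) directed graph on vertices $v_1,\dots,v_n$ whose arcs, counted with multiplicity, are the following: each odd-indexed entry $a_t$ contributes one arc $(v_i,v_j)$ for every pair $i<j$ with $i+a_t\ge j$; each even-indexed entry $a_s$ contributes one arc $(v_i,v_j)$ for every pair $i>j$ with $i-a_s\le j$. The generalised ornated graph $O_n(s_{l_1},\dots,s_{l_t})=\sum_{i=1}^{t}O_n(s_{l_i})$ is obtained by applying the strings consecutively to the same $n$ vertices: its vertex set is $\{v_1,\dots,v_n\}$ and its arc multiplicities are the sums of the arc multiplicities of the graphs $O_n(s_{l_i})$ (each string having its own indexing). The degree of a vertex is $d(v)=d^+(v)+d^-(v)$ (out-degree plus in-degree, with multiplicity), and $\Delta$ denotes the maximum degree. -}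

module Defs where

open import Algebra.Properties.CommutativeMonoid.Sum using (sum)
open import Data.Bool.Base using (if_then_else_)
open import Data.Fin.Base using (Fin; toℕ)
open import Data.Nat.Base using (ℕ; suc; _+_; _⊔_; _≤_; NonZero; parity)
open import Data.Nat.Properties using (+-0-commutativeMonoid; _<?_; _≤?_)
open import Data.Parity.Base using (0ℙ; 1ℙ)
open import Data.Product.Base using (_×_)
open import Data.Vec.Functional using (Vector; foldr)
open import Relation.Nullary.Decidable using (Dec; does; _×-dec_)

∑ : ∀ {n} → Vector ℕ n → ℕ
∑ = sum +-0-commutativeMonoid

-- Junk value 0 on the empty vector.
maximum : ∀ {n} → Vector ℕ n → ℕ
maximum = foldr _⊔_ 0

indicator : ∀ {P : Set} → Dec P → ℕ
indicator P? = if does P? then 1 else 0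

record OrderedString : Set where
  field
    length        : ℕ
    .{{nonEmpty}} : NonZero length
    entry         : Vector ℕ length

open OrderedString public

maxEntry : OrderedString → ℕ
maxEntry s = maximum (entry s)

-- A directed multigraph on n vertices: G i j is the number of arcs (i , j).
MultiDigraph : ℕ → Set
MultiDigraph n = Fin n → Fin n → ℕ

-- The arcs contributed by an entry a whose (1-based) index is k.  Vertex
-- v_{i+1} is the element i of Fin n; the conditions only depend on
-- differences of vertex subscripts.  In the even case, i - a ≤ j is written
-- without subtraction as i ≤ j + a.
entryArcs : ∀ {n} (k a : ℕ) → MultiDigraph n
entryArcs k a i j with parity k
... | 1ℙ = indicator ((toℕ i <? toℕ j) ×-dec (toℕ j ≤? toℕ i + a))
... | 0ℙ = indicator ((toℕ j <? toℕ i) ×-dec (toℕ i ≤? toℕ j + a))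

ornated : (n : ℕ) → OrderedString → MultiDigraph n
ornated n s i j = ∑ λ p → entryArcs (suc (toℕ p)) (entry s p) i j

generalisedOrnated : (n : ℕ) {t : ℕ} → Vector OrderedString t → MultiDigraph n
generalisedOrnated n s i j = ∑ λ r → ornated n (s r) i j

outDegree inDegree degree : ∀ {n} → MultiDigraph n → Fin n → ℕ
outDegree G v = ∑ λ w → G v w
inDegree  G v = ∑ λ w → G w v
degree    G v = outDegree G v + inDegree G v

Δ : ∀ {n} → MultiDigraph n → ℕ
Δ G = maximum (degree G)

AttainsMaxDegree : (∀ n → MultiDigraph n) → ℕ → Set
AttainsMaxDegree G n = 1 ≤ n × (∀ n' → 1 ≤ n' → Δ (G n') ≤ Δ (G n))

IsSmallestOrderAttainingMaxDegree : (∀ n → MultiDigraph n) → ℕ → Set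
IsSmallestOrderAttainingMaxDegree G n =
  AttainsMaxDegree G n × (∀ m → AttainsMaxDegree G m → n ≤ m)

{-# OPTIONS --safe #-}

-- An entry a joins a vertex v, by exactly one arc, to each vertex at distance
-- at most a, on both sides and regardless of the parity of its index.  With i
-- vertices before v and j after it, a therefore contributes
-- min(a, i) + min(a, j) ≤ 2a to the degree of v, with equality iff a ≤ i and
-- a ≤ j.  So the degree is bounded by twice the sum of all entries, and a vertex
-- reaches this bound iff it has at least K vertices on each side, K being the
-- largest entry.  On 2K + 1 vertices the middle vertex does, simultaneously for
-- every string.
module Submission where

open import Defs
open import Data.Fin.Base using (Fin; zero; suc; toℕ; fromℕ<)
open import Data.Fin.Properties using (toℕ<n; toℕ-fromℕ<)
open import Data.Nat.Base using (ℕ; zero; suc; _+_; _*_; _∸_; _⊓_; _≤_; _<_; z≤n; s≤s; NonZero; parity)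
open import Data.Nat.Properties
open import Data.Nat.Tactic.RingSolver using (solve-∀)
open import Data.Parity.Base using (0ℙ; 1ℙ)
open import Data.Product.Base using (_×_; _,_; ∃; proj₁; proj₂)
open import Data.Sum.Base using (inj₁; inj₂)
open import Data.Vec.Functional using (Vector; tail)
open import Function.Base using (_∘_)
open import Relation.Binary.PropositionalEquality using (_≡_; refl; sym; trans; cong; cong₂; subst)
open import Relation.Nullary.Decidable using (_×-dec_)

open import Algebra.Properties.CommutativeMonoid.Sum +-0-commutativeMonoid using (sum-cong-≗; sum-replicate-zero; ∑-distrib-+; ∑-comm)

+-cancel-≤-≤ : ∀ {a b c d} → a ≤ c → b ≤ d → c + d ≤ a + b → c ≤ a × d ≤ b
+-cancel-≤-≤ {a} {b} {c} {d} a≤c b≤d c+d≤a+b =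
    +-cancelʳ-≤ d c a (≤-trans c+d≤a+b (+-monoʳ-≤ a b≤d))
  , +-cancelˡ-≤ c d b (≤-trans c+d≤a+b (+-monoˡ-≤ b a≤c))

∑-mono-≤ : ∀ {n} {f g : Vector ℕ n} → (∀ i → f i ≤ g i) → ∑ f ≤ ∑ g
∑-mono-≤ {zero}  f≤g = z≤n
∑-mono-≤ {suc n} f≤g = +-mono-≤ (f≤g zero) (∑-mono-≤ (f≤g ∘ suc))

-- Termwise bounds whose total is reached leave no slack in any term. This carries tightness of the
-- degree bound from the whole graph down to its strings and their entries.
∑-cancel-≤ : ∀ {n} {f g : Vector ℕ n} → (∀ i → f i ≤ g i) → ∑ g ≤ ∑ f → ∀ i → g i ≤ f i
∑-cancel-≤ {suc n} f≤g ∑g≤∑f i with +-cancel-≤-≤ (f≤g zero) (∑-mono-≤ (f≤g ∘ suc)) ∑g≤∑f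
∑-cancel-≤ {suc n} f≤g ∑g≤∑f zero    | g₀≤f₀ , _     = g₀≤f₀
∑-cancel-≤ {suc n} f≤g ∑g≤∑f (suc i) | _     , tails = ∑-cancel-≤ (f≤g ∘ suc) tails i

lookup≤maximum : ∀ {n} (f : Vector ℕ n) i → f i ≤ maximum f
lookup≤maximum f zero    = m≤m⊔n _ _
lookup≤maximum f (suc i) = m≤n⇒m≤o⊔n (f zero) (lookup≤maximum (tail f) i)

maximum-lub : ∀ {n b} (f : Vector ℕ n) → (∀ i → f i ≤ b) → maximum f ≤ b
maximum-lub {zero}  f f≤b = z≤n
maximum-lub {suc n} f f≤b = ⊔-lub (f≤b zero) (maximum-lub (tail f) (f≤b ∘ suc))

-- On the empty vector `maximum` is a default 0 that no index realises; the induction starts at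
-- length 1, where `⊔-identityʳ` absorbs that 0.
maximum-attained : ∀ {n} (f : Vector ℕ n) → 1 ≤ n → ∃ λ i → maximum f ≡ f i
maximum-attained {suc zero}    f _ = zero , ⊔-identityʳ (f zero)
maximum-attained {suc (suc n)} f _ with maximum-attained (tail f) (s≤s z≤n) | ⊔-sel (f zero) (maximum (tail f))
... | _ , _  | inj₁ head = zero , head
... | i , eq | inj₂ rest = suc i , trans rest eq

maximum-unique : ∀ {n b} (f : Vector ℕ n) i → (∀ j → f j ≤ b) → f i ≡ b → maximum f ≡ b
maximum-unique f i f≤b fi≡b =
  ≤-antisym (maximum-lub f f≤b) (≤-trans (≤-reflexive (sym fi≡b)) (lookup≤maximum f i))

countBelow : ∀ n a → ∑ {n} (λ w → indicator (toℕ w <? a)) ≡ a ⊓ n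
countBelow zero    a       = sym (⊓-zeroʳ a)
countBelow (suc n) zero    = sum-replicate-zero (suc n)
countBelow (suc n) (suc a) = cong suc (countBelow n a)

-- Lets the counts below recurse by shifting all positions by one. The test `suc z ≤? suc w` is
-- stuck until `z` is a constructor, hence the split with `refl` in both cases.
indicator-suc : ∀ x y z w →
  indicator ((suc x <? suc y) ×-dec (suc z ≤? suc w)) ≡ indicator ((x <? y) ×-dec (z ≤? w))
indicator-suc x y zero    w = refl
indicator-suc x y (suc z) w = refl

countAfter : ∀ n a x → ∑ {n} (λ w → indicator ((x <? toℕ w) ×-dec (toℕ w ≤? x + a))) ≡ a ⊓ (n ∸ suc x)
countAfter zero    a x       = sym (⊓-zeroʳ a)
-- The summand at position 0 vanishes, and for the others `suc w ≤ a` is by definition `w < a`.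
countAfter (suc n) a zero    = countBelow n a
countAfter (suc n) a (suc x) =
  trans (sum-cong-≗ {n} λ w → indicator-suc x (toℕ w) (toℕ w) (x + a)) (countAfter n a x)

indicator-<?-⊓ : ∀ a x → indicator (x <? a) + (a ⊓ x) ≡ a ⊓ suc x
indicator-<?-⊓ zero    x       = refl
indicator-<?-⊓ (suc a) zero    = cong suc (sym (⊓-zeroʳ a))
indicator-<?-⊓ (suc a) (suc x) = trans (+-suc _ (a ⊓ x)) (cong suc (indicator-<?-⊓ a x))

countBefore : ∀ n a x → x ≤ n → ∑ {n} (λ w → indicator ((toℕ w <? x) ×-dec (x ≤? toℕ w + a))) ≡ a ⊓ x
countBefore n       a zero    _         = trans (sum-replicate-zero n) (sym (⊓-zeroʳ a))
countBefore (suc n) a (suc x) (s≤s x≤n) =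
  -- Vertex 0 lies before `suc x` and is within reach iff `x < a`; the remaining vertices give the
  -- count for `x`, shifted by one.
  trans (cong (indicator (x <? a) +_) (trans (sum-cong-≗ {n} λ w → indicator-suc (toℕ w) x x (toℕ w + a)) (countBefore n a x x≤n)))
        (indicator-<?-⊓ a x)

degree-entryArcs : ∀ {n} k a (v : Fin n) →
  degree (entryArcs k a) v ≡ (a ⊓ toℕ v) + (a ⊓ (n ∸ suc (toℕ v)))
degree-entryArcs {n} k a v with parity k
-- At an odd index the out-arcs lead to later vertices, so the two counts come in the opposite
-- order.
... | 1ℙ = trans (cong₂ _+_ (countAfter n a (toℕ v)) (countBefore n a (toℕ v) (<⇒≤ (toℕ<n v)))) (+-comm (a ⊓ (n ∸ suc (toℕ v))) _)
... | 0ℙ = cong₂ _+_ (countBefore n a (toℕ v) (<⇒≤ (toℕ<n v))) (countAfter n a (toℕ v))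

degree-∑ : ∀ {n t} (G : Fin t → MultiDigraph n) v →
  degree (λ i j → ∑ λ r → G r i j) v ≡ ∑ λ r → degree (G r) v
degree-∑ G v = trans
  (cong₂ _+_ (∑-comm (λ w r → G r v w)) (∑-comm (λ w r → G r w v)))
  (sym (∑-distrib-+ (λ r → outDegree (G r) v) (λ r → inDegree (G r) v)))

degree-entryArcs-≤ : ∀ {n} k a (v : Fin n) → degree (entryArcs k a) v ≤ a + a
degree-entryArcs-≤ k a v = ≤-trans (≤-reflexive (degree-entryArcs k a v)) (+-mono-≤ (m⊓n≤m a _) (m⊓n≤m a _))

-- `n ∸ suc (toℕ v)` is the number of vertices after `v`; the subtraction is exact because
-- `toℕ v < n`.
HasMargin : ∀ {n} → ℕ → Fin n → Set
HasMargin {n} a v = a ≤ toℕ v × a ≤ n ∸ suc (toℕ v)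

degree-entryArcs-margin : ∀ {n} k a (v : Fin n) → HasMargin a v → degree (entryArcs k a) v ≡ a + a
degree-entryArcs-margin k a v (a≤i , a≤j) =
  trans (degree-entryArcs k a v) (cong₂ _+_ (m≤n⇒m⊓n≡m a≤i) (m≤n⇒m⊓n≡m a≤j))

-- Two minima with `a` that add up to `a + a` must both equal `a`, so `a` is at most the other
-- argument of each.
margin-entryArcs : ∀ {n} k a (v : Fin n) → a + a ≤ degree (entryArcs k a) v → HasMargin a v
margin-entryArcs {n} k a v 2a≤deg
  with +-cancel-≤-≤ (m⊓n≤m a (toℕ v)) (m⊓n≤m a (n ∸ suc (toℕ v))) (≤-trans 2a≤deg (≤-reflexive (degree-entryArcs k a v)))
... | a≤₁ , a≤₂ = ≤-trans a≤₁ (m⊓n≤n a _) , ≤-trans a≤₂ (m⊓n≤n a _)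

HasMargin-≤ : ∀ {n a b} {v : Fin n} → a ≤ b → HasMargin b v → HasMargin a v
HasMargin-≤ a≤b (b≤i , b≤j) = ≤-trans a≤b b≤i , ≤-trans a≤b b≤j

HasMargin-maximum : ∀ {n t} (f : Vector ℕ t) {v : Fin n} → (∀ i → HasMargin (f i) v) → HasMargin (maximum f) v
HasMargin-maximum f margin = maximum-lub f (proj₁ ∘ margin) , maximum-lub f (proj₂ ∘ margin)

2a+1≡1+a+a : ∀ a → 2 * a + 1 ≡ suc a + a
2a+1≡1+a+a = solve-∀

-- The vertices before `v`, `v` itself and the vertices after it make up all `n`.
HasMargin⇒order : ∀ {n a} {v : Fin n} → HasMargin a v → 2 * a + 1 ≤ n
HasMargin⇒order {n} {a} {v} (a≤i , a≤j) = begin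
  2 * a + 1                           ≡⟨ 2a+1≡1+a+a a ⟩
  suc a + a                           ≤⟨ +-mono-≤ (s≤s a≤i) a≤j ⟩
  suc (toℕ v) + (n ∸ suc (toℕ v))     ≡⟨ m+[n∸m]≡n (toℕ<n v) ⟩
  n                                   ∎
  where open ≤-Reasoning

-- The centre is at position `a`, counted from 0, with `a` vertices on either side.
HasMargin-centre : ∀ a → ∃ λ (c : Fin (2 * a + 1)) → HasMargin a c
HasMargin-centre a = fromℕ< a<n , ≤-reflexive (sym toℕ-c) , ≤-reflexive (sym after)
  where
  a<n : a < 2 * a + 1
  a<n = subst (a <_) (sym (2a+1≡1+a+a a)) (m≤m+n (suc a) a)
  toℕ-c = toℕ-fromℕ< a<n
  after : 2 * a + 1 ∸ suc (toℕ (fromℕ< a<n)) ≡ a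
  after = trans (cong₂ _∸_ (2a+1≡1+a+a a) (cong suc toℕ-c)) (m+n∸m≡n (suc a) a)

degreeBound : OrderedString → ℕ
degreeBound s = ∑ λ p → entry s p + entry s p

module _ {n} (s : OrderedString) (v : Fin n) where

  private
    arcs : Fin (length s) → MultiDigraph n
    arcs p = entryArcs (suc (toℕ p)) (entry s p)

    arcs-≤ : ∀ p → degree (arcs p) v ≤ entry s p + entry s p
    arcs-≤ p = degree-entryArcs-≤ (suc (toℕ p)) (entry s p) v

  degree-ornated-≤ : degree (ornated n s) v ≤ degreeBound s
  degree-ornated-≤ = ≤-trans (≤-reflexive (degree-∑ arcs v)) (∑-mono-≤ arcs-≤)

  degree-ornated-margin : HasMargin (maxEntry s) v → degree (ornated n s) v ≡ degreeBound s
  degree-ornated-margin margin = trans (degree-∑ arcs v) (sum-cong-≗ λ p →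
    degree-entryArcs-margin (suc (toℕ p)) _ v (HasMargin-≤ {v = v} (lookup≤maximum (entry s) p) margin))

  -- Reaching the total bound forces each entry to reach its own, and the margins for all entries
  -- give the one for the largest.
  margin-ornated : degreeBound s ≤ degree (ornated n s) v → HasMargin (maxEntry s) v
  margin-ornated bound≤deg = HasMargin-maximum (entry s) {v} λ p → margin-entryArcs (suc (toℕ p)) _ v
    (∑-cancel-≤ arcs-≤ (≤-trans bound≤deg (≤-reflexive (degree-∑ arcs v))) p)

module _ {n t} (s : Vector OrderedString t) (v : Fin n) where

  private
    degree-split : degree (generalisedOrnated n s) v ≡ ∑ λ r → degree (ornated n (s r)) v
    degree-split = degree-∑ (λ r → ornated n (s r)) v

  degree-generalisedOrnated-≤ : degree (generalisedOrnated n s) v ≤ ∑ (degreeBound ∘ s)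
  degree-generalisedOrnated-≤ = ≤-trans (≤-reflexive degree-split) (∑-mono-≤ λ r → degree-ornated-≤ (s r) v)

  degree-generalisedOrnated-margin : HasMargin (maximum (maxEntry ∘ s)) v →
    degree (generalisedOrnated n s) v ≡ ∑ (degreeBound ∘ s)
  degree-generalisedOrnated-margin margin = trans degree-split (sum-cong-≗ λ r →
    degree-ornated-margin (s r) v (HasMargin-≤ {v = v} (lookup≤maximum (maxEntry ∘ s) r) margin))

  margin-generalisedOrnated : ∑ (degreeBound ∘ s) ≤ degree (generalisedOrnated n s) v →
    HasMargin (maximum (maxEntry ∘ s)) v
  margin-generalisedOrnated bound≤deg = HasMargin-maximum (maxEntry ∘ s) {v} λ r → margin-ornated (s r) v
    (∑-cancel-≤ (λ r → degree-ornated-≤ (s r) v) (≤-trans bound≤deg (≤-reflexive degree-split)) r)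

theorem4p2 : (t : ℕ) .{{_ : NonZero t}} (s : Vector OrderedString t) →
    let n = 2 * maximum (λ i → maxEntry (s i)) + 1 in
    IsSmallestOrderAttainingMaxDegree (λ m → generalisedOrnated m s) n
    × Δ (generalisedOrnated n s) ≡ ∑ (λ j → Δ (ornated n (s j)))
theorem4p2 t s with HasMargin-centre (maximum (maxEntry ∘ s))
... | c , margin = ((1≤n , attains) , smallest) , trans Δ-n (sum-cong-≗ (sym ∘ Δ-ornated))
  where
  n = 2 * maximum (maxEntry ∘ s) + 1

  1≤n : 1 ≤ n
  1≤n = m≤n+m 1 _

  Δ-n : Δ (generalisedOrnated n s) ≡ ∑ (degreeBound ∘ s)
  Δ-n = maximum-unique (degree (generalisedOrnated n s)) c
    (degree-generalisedOrnated-≤ s) (degree-generalisedOrnated-margin s c margin)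

  -- Even if `n` exceeds the order that string `j` alone requires, `c` has the margin for it and so
  -- realises its bound.
  Δ-ornated : ∀ j → Δ (ornated n (s j)) ≡ degreeBound (s j)
  Δ-ornated j = maximum-unique (degree (ornated n (s j))) c (degree-ornated-≤ (s j))
    (degree-ornated-margin (s j) c (HasMargin-≤ {v = c} (lookup≤maximum (maxEntry ∘ s) j) margin))

  attains : ∀ n' → 1 ≤ n' → Δ (generalisedOrnated n' s) ≤ Δ (generalisedOrnated n s)
  attains n' _ = ≤-trans (maximum-lub (degree (generalisedOrnated n' s)) (degree-generalisedOrnated-≤ s)) (≤-reflexive (sym Δ-n))

  smallest : ∀ m → AttainsMaxDegree (λ m → generalisedOrnated m s) m → n ≤ m
  -- `1≤m` supplies a vertex `v` of maximum degree. Comparing `m` with the order `n` shows that `v`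
  -- reaches the full bound, so it has margin `K` on both sides.
  smallest m (1≤m , Δ≤Δm) with maximum-attained (degree (generalisedOrnated m s)) 1≤m
  ... | v , Δm≡deg = HasMargin⇒order {v = v} (margin-generalisedOrnated s v bound≤deg)
    where
    open ≤-Reasoning
    bound≤deg : ∑ (degreeBound ∘ s) ≤ degree (generalisedOrnated m s) v
    bound≤deg = begin
      ∑ (degreeBound ∘ s)                  ≡⟨ Δ-n ⟨
      Δ (generalisedOrnated n s)           ≤⟨ Δ≤Δm n 1≤n ⟩
      Δ (generalisedOrnated m s)           ≡⟨ Δm≡deg ⟩
      degree (generalisedOrnated m s) v    ∎
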